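{- The chair tiling has chromatic index $4$. (This holds for either of the two choices of vertices (a), (b) described in the context.)
   Context: Chair substitution. The prototile is the L-shaped polygon $C=\overline{[0,2]^2\setminus[1,2]^2}$ (a union of three unit squares). The substitution $\omega$ replaces $C$ by the dissection of $2C=\overline{[0,4]^2\setminus[2,4]^2}$ into four tiles congruent to $C$: the tile $C$; the tile $C+(1,1)$; the tile $\overline{[0,2]\times[2,4]\setminus[1,2]\times[2,3]}$; and the tile $\overline{[2,4]\times[0,2]\setminus[2,3]\times[1,2]}$. It is extended to translates and rotations (by multiples of $90^\circ$) of $C$, and to collections of such tiles, in the obvious covariant way (expand by the factor 2, then dissect each expanded tile). The chair tiling is the fixed point tiling of the plane produced by this substitution. It is regarded as an infinite planar graph whose faces are the tiles, and whose edges are the pieces of tile boundaries between consecutive vertices. Choices of vertices. (a) Every tile has 8 vertices: for the tile $C$ these are $(0,0),(1,0),(2,0),(2,1),(1,1),(1,2),(0,2),(0,1)$, and correspondingly for every translated or rotated tile. (b) Vertices are inserted only where 90 degree edges meet, or equivalently (in the paper's words) only vertices of degree at least 3 are inserted, making the graph a map. The chromatic index is the least number of colours in a proper edge colouring (distinct edges sharing an endpoint get different colours). -}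

module Defs where

open import Data.Fin using (Fin; toℕ; #_)
open import Data.Integer using (ℤ; +_; -_; _+_; _*_; pred; 0ℤ; 1ℤ)
open import Data.List using (List; []; _∷_; map)
open import Data.List.Membership.Propositional using (_∈_)
open import Data.Nat using (ℕ; suc; NonZero; _<_)
open import Data.Nat.DivMod using (_mod_)
open import Data.Nat.GeneralisedArithmetic using (fold)
open import Data.Product using (Σ; ∃; ∃-syntax; ∃!; _×_; _,_; proj₁)
open import Data.Sum using (_⊎_)
open import Data.Vec using (Vec; []; _∷_; lookup)
open import Function using (_∘_)
open import Function.Definitions using (Injective)
open import Level using (0ℓ)
open import Relation.Binary.Bundles using (Setoid)
open import Relation.Binary.Construct.Closure.Equivalence using (setoid)
open import Relation.Binary.PropositionalEquality using (_≡_; _≢_)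
open import Relation.Nullary using (¬_)
open import Relation.Unary using (Pred; _≐_)

-- Multigraphs: two vertices may be joined by several edges, so edges are
-- objects in their own right, taken up to a setoid equality.

record Graph : Set₁ where
  field
    Vertex   : Set
    edges    : Setoid 0ℓ 0ℓ
    Incident : Vertex → Setoid.Carrier edges → Set
  open Setoid edges public using (_≈_) renaming (Carrier to Edge)

record ProperEdgeColouring (G : Graph) (k : ℕ) : Set where
  open Graph G
  field
    colour : Edge → Fin k
    cong   : ∀ {e f} → e ≈ f → colour e ≡ colour f
    proper : ∀ {v e f} → Incident v e → Incident v f → ¬ (e ≈ f) →
             colour e ≢ colour f

HasChromaticIndex : Graph → ℕ → Set
HasChromaticIndex G k =
  ProperEdgeColouring G k × (∀ m → m < k → ¬ ProperEdgeColouring G m)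

Point : Set
Point = ℤ × ℤ

infixl 6 _⊕_

_⊕_ : Point → Point → Point
(x , y) ⊕ (x′ , y′) = (x + x′ , y + y′)

double : Point → Point
double (x , y) = (+ 2 * x , + 2 * y)

-- Anticlockwise rotation by 90 degrees about the origin.
turn : Point → Point
turn (x , y) = (- y , x)

cyclicSuc : ∀ {n} .{{_ : NonZero n}} → Fin n → Fin n
cyclicSuc {n} i = suc (toℕ i) mod n

-- A cell (x , y) is the unit square [x, x+1] × [y, y+1]; rotating it moves
-- its lower left corner to the lower right one, hence the extra -1.
Cell : Set
Cell = ℤ × ℤ

turnCell : Cell → Cell
turnCell (x , y) = (pred (- y) , x)

-- tile r p is the chair C, rotated r times by 90 degrees about the origin
-- and then translated by p.  C has no rotational symmetry, so distinct
-- values are distinct tiles.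
record Tile : Set where
  constructor tile
  field
    turns  : Fin 4
    offset : Point

cellsC : List Cell
cellsC = (0ℤ , 0ℤ) ∷ (1ℤ , 0ℤ) ∷ (0ℤ , 1ℤ) ∷ []

cells : Tile → List Cell
cells (tile r p) = map (λ c → p ⊕ fold c turnCell (toℕ r)) cellsC

-- In cyclic order along the boundary of C.
verticesC : Vec Point 8
verticesC = (+ 0 , + 0) ∷ (+ 1 , + 0) ∷ (+ 2 , + 0) ∷ (+ 2 , + 1)
          ∷ (+ 1 , + 1) ∷ (+ 1 , + 2) ∷ (+ 0 , + 2) ∷ (+ 0 , + 1) ∷ []

vertex : Tile → Fin 8 → Point
vertex (tile r p) i = p ⊕ fold (lookup verticesC i) turn (toℕ r)

turnTile : Tile → Tile
turnTile (tile r p) = tile (cyclicSuc r) (turn p)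

translate : Point → Tile → Tile
translate q (tile r p) = tile r (q ⊕ p)

-- The last two are [0,2]×[2,4] without [1,2]×[2,3] and [2,4]×[0,2] without
-- [2,3]×[1,2].
dissectionC : List Tile
dissectionC = tile (# 0) (+ 0 , + 0)
            ∷ tile (# 0) (+ 1 , + 1)
            ∷ tile (# 3) (+ 0 , + 4)
            ∷ tile (# 1) (+ 4 , + 0)
            ∷ []

dissection : Tile → List Tile
dissection (tile r p) =
  map (λ t → translate (double p) (fold t turnTile (toℕ r))) dissectionC

Collection : Set₁
Collection = Pred Tile 0ℓ

ω : Collection → Collection
ω T u = ∃[ t ] T t × u ∈ dissection t

-- Tiles are unions of cells, so covering the plane without overlaps of
-- interiors means that every cell lies in exactly one tile.
IsTiling : Collection → Set
IsTiling T = ∀ (c : Cell) → ∃! _≡_ λ t → T t × c ∈ cells t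

IsChairTiling : Collection → Set
IsChairTiling T = IsTiling T × T ≐ ω T

data Axis : Set where
  horizontal vertical : Axis

record Segment : Set where
  constructor segment
  field
    start : Point
    axis  : Axis

  end : Point
  end with axis
  ... | horizontal = start ⊕ (+ 1 , + 0)
  ... | vertical   = start ⊕ (+ 0 , + 1)

_EndpointOf_ : Point → Segment → Set
p EndpointOf s = p ≡ Segment.start s ⊎ p ≡ Segment.end s

_Joins_,_ : Segment → Point → Point → Set
s Joins p , q = (Segment.start s ≡ p × Segment.end s ≡ q)
              ⊎ (Segment.start s ≡ q × Segment.end s ≡ p)

_SideOf_ : Segment → Tile → Set
s SideOf t = ∃[ i ] s Joins vertex t i , vertex t (cyclicSuc i)

OnBoundary : Collection → Segment → Set
OnBoundary T s = ∃[ t ] T t × s SideOf t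

BoundarySegment : Collection → Set
BoundarySegment T = Σ Segment (OnBoundary T)

-- The graph of T in which the lattice points satisfying V are the vertices.
-- Its edges are the pieces of tile boundaries between consecutive vertices:
-- classes of boundary segments, where segments meeting in a point which is
-- not a vertex belong to the same piece.
module _ (T : Collection) (V : Pred Point 0ℓ) where

  Linked : BoundarySegment T → BoundarySegment T → Set
  Linked (s , _) (s′ , _) =
    s ≡ s′ ⊎ ∃[ p ] ¬ V p × p EndpointOf s × p EndpointOf s′

  pieces : Setoid 0ℓ 0ℓ
  pieces = setoid Linked

  tilingGraph : Graph
  tilingGraph = record
    { Vertex   = ∃ V
    ; edges    = pieces
    ; Incident = λ (p , _) e →
        ∃[ f ] Setoid._≈_ pieces e f × p EndpointOf proj₁ f
    }

EightPerTile : Collection → Pred Point 0ℓ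
EightPerTile T p = ∃[ t ] T t × ∃[ i ] vertex t i ≡ p

-- At least three distinct boundary segments emanate from p.
DegreeAtLeastThree : Collection → Pred Point 0ℓ
DegreeAtLeastThree T p =
  Σ (Fin 3 → Segment) λ s → Injective _≡_ _≡_ s ×
    (∀ i → OnBoundary T (s i) × p EndpointOf s i)

{-# OPTIONS --safe #-}
module Submission where

-- Record a tile by its reflex vertex, which it surrounds by three of the four
-- cells at that point, and label every cell by its position (its arrow) around
-- the reflex vertex of its tile.  The four arrows at a point decide which of
-- the segments there are boundary segments, and the substitution acts on
-- arrows: the quarters of a doubled cell are labelled by its own arrow alone.
-- A segment is coloured by its direction and the arrows of the one or two
-- cells, one level up, on its sides.  Only 22 configurations of four arrows
-- satisfy the parity and tile constraints at a point one level up, so that the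
-- colouring is verified on these for all points below.  Finally, at twice any
-- point with odd coordinate sum all four cells point away, and four segments
-- meet, whence the lower bound; for it the four pieces must be distinct, which
-- the colouring itself shows.  With eight vertices per tile the edges are unit
-- segments, coloured by axis and parity.

open import Defs
open import Data.Bool using (if_then_else_)
open import Data.Fin using (Fin; zero; suc; toℕ; fromℕ<; #_; punchIn; _↑ˡ_; _↑ʳ_)
open import Data.Fin.Properties as Fin
  using (all?; any?; _≟_; pigeonhole; punchIn-injective; punchInᵢ≢i)
open import Data.Integer as ℤ using (ℤ; +_; -_; _+_; _*_)
open import Data.Integer.DivMod using (_/ℕ_; _%ℕ_; n%ℕd<d; a≡a%ℕn+[a/ℕn]*n)
import Data.Integer.Properties as ℤ
open import Algebra.Properties.AbelianGroup ℤ.+-0-abelianGroup using (∙-cancelˡ; ∙-cancelʳ; xyx⁻¹≈y)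
open import Data.List.Membership.Propositional using (_∈_; find)
open import Data.List.Membership.Propositional.Properties using (∈-map⁺; ∈-map⁻)
open import Data.List.Relation.Unary.Any as Any using (Any)
import Data.List.Relation.Unary.Any.Properties as Any
open import Data.List.Relation.Unary.All as All using (All)
import Data.Nat as ℕ
open import Data.Nat.DivMod using (_mod_)
import Data.Nat.Properties as ℕ
open import Data.Nat.GeneralisedArithmetic using (fold)
open import Data.Product using (∃; _×_; _,_; proj₁; proj₂; uncurry)
open import Data.Product.Properties using (≡-dec)
open import Data.Sum using (_⊎_; inj₁; inj₂; [_,_]′)
open import Data.Vec using (Vec; []; _∷_; lookup; tabulate)
open import Data.Vec.Properties using (lookup∘tabulate; tabulate-cong)
open import Function using (_∘_; id; case_of_)
open import Level using (0ℓ)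
open import Relation.Binary.Bundles using (Setoid)
import Relation.Binary.Construct.Closure.Equivalence as EqClosure
open import Relation.Binary.Definitions using (DecidableEquality)
open import Relation.Binary.PropositionalEquality
  using (_≡_; _≢_; refl; sym; trans; cong; cong₂; subst; subst₂; isEquivalence; module ≡-Reasoning)
open import Relation.Nullary
  using (Dec; yes; no; does; ¬_; contradiction; ¬?; _×-dec_; _⊎-dec_; _→-dec_)
open import Relation.Nullary.Decidable using (map′; True; toWitness)
open import Relation.Unary using (Pred)

decide : ∀ {A : Set} (a? : Dec A) {_ : True a?} → A
decide _ {holds} = toWitness holds

-- Arithmetic of lattice points.

infix 4 _≟ₚ_

_≟ₚ_ : DecidableEquality Point
_≟ₚ_ = ≡-dec ℤ._≟_ ℤ._≟_

𝟎 𝟏 : Point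
𝟎 = (+ 0 , + 0)
𝟏 = (+ 1 , + 1)

⊖_ : Point → Point
⊖ (x , y) = (- x , - y)

⊕-assoc : ∀ p q r → (p ⊕ q) ⊕ r ≡ p ⊕ (q ⊕ r)
⊕-assoc (x , y) (x′ , y′) (x″ , y″) =
  cong₂ _,_ (ℤ.+-assoc x x′ x″) (ℤ.+-assoc y y′ y″)

⊕-comm : ∀ p q → p ⊕ q ≡ q ⊕ p
⊕-comm (x , y) (x′ , y′) = cong₂ _,_ (ℤ.+-comm x x′) (ℤ.+-comm y y′)

⊕-identityʳ : ∀ p → p ⊕ 𝟎 ≡ p
⊕-identityʳ (x , y) = cong₂ _,_ (ℤ.+-identityʳ x) (ℤ.+-identityʳ y)

⊕-identityˡ : ∀ p → 𝟎 ⊕ p ≡ p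
⊕-identityˡ (x , y) = cong₂ _,_ (ℤ.+-identityˡ x) (ℤ.+-identityˡ y)

⊕-inverseʳ : ∀ p → p ⊕ (⊖ p) ≡ 𝟎
⊕-inverseʳ (x , y) = cong₂ _,_ (ℤ.+-inverseʳ x) (ℤ.+-inverseʳ y)

⊕-cancelˡ : ∀ p {q r} → p ⊕ q ≡ p ⊕ r → q ≡ r
⊕-cancelˡ (x , y) eq =
  cong₂ _,_ (∙-cancelˡ x _ _ (cong proj₁ eq)) (∙-cancelˡ y _ _ (cong proj₂ eq))

⊕-cancelʳ : ∀ p {q r} → q ⊕ p ≡ r ⊕ p → q ≡ r
⊕-cancelʳ p {q} {r} eq =
  ⊕-cancelˡ p (trans (⊕-comm p q) (trans eq (⊕-comm r p)))

double-⊕ : ∀ p q → double (p ⊕ q) ≡ double p ⊕ double q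
double-⊕ (x , y) (x′ , y′) =
  cong₂ _,_ (ℤ.*-distribˡ-+ (+ 2) x x′) (ℤ.*-distribˡ-+ (+ 2) y y′)

-- Halving: quotients and residues modulo 2.

bit : ℤ → Fin 2
bit z = fromℕ< (n%ℕd<d z 2)

decompose : ∀ z → z ≡ + 2 * (z /ℕ 2) + + toℕ (bit z)
decompose z = begin
  z                                  ≡⟨ a≡a%ℕn+[a/ℕn]*n z 2 ⟩
  + (z %ℕ 2) + (z /ℕ 2) * + 2        ≡⟨ ℤ.+-comm (+ (z %ℕ 2)) ((z /ℕ 2) * + 2) ⟩
  (z /ℕ 2) * + 2 + + (z %ℕ 2)        ≡⟨ cong₂ (λ x n → x + + n) (ℤ.*-comm (z /ℕ 2) (+ 2))
                                          (sym (Fin.toℕ-fromℕ< (n%ℕd<d z 2))) ⟩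
  + 2 * (z /ℕ 2) + + toℕ (bit z)     ∎
  where open ≡-Reasoning

-- Otherwise twice an integer would be 1; absolute values carry this to parity in `ℕ`.
odd≢even : ∀ x y → + 2 * x + + 1 ≢ + 2 * y + + 0
odd≢even x y eq = ℕ.even≢odd ℤ.∣ y ℤ.- x ∣ 0
  (trans (sym (ℤ.abs-* (+ 2) (y ℤ.- x))) (cong ℤ.∣_∣ 2[y-x]≡1))
  where
  open ≡-Reasoning
  2[y-x]≡1 : + 2 * (y ℤ.- x) ≡ + 1
  2[y-x]≡1 = begin
    + 2 * (y ℤ.- x)                     ≡⟨ ℤ.*-distribˡ-+ (+ 2) y (- x) ⟩
    + 2 * y + + 2 * - x
      ≡⟨ cong₂ _+_ (trans (sym (ℤ.+-identityʳ (+ 2 * y))) (sym eq)) (sym (ℤ.neg-distribʳ-* (+ 2) x)) ⟩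
    (+ 2 * x + + 1) ℤ.- (+ 2 * x)       ≡⟨ xyx⁻¹≈y (+ 2 * x) (+ 1) ⟩
    + 1                                 ∎

decompose-unique : ∀ x y (i j : Fin 2) → + 2 * x + + toℕ i ≡ + 2 * y + + toℕ j → x ≡ y × i ≡ j
decompose-unique x y zero       zero       eq = ℤ.*-cancelˡ-≡ (+ 2) x y (∙-cancelʳ (+ 0) _ _ eq) , refl
decompose-unique x y zero       (suc zero) eq = contradiction (sym eq) (odd≢even y x)
decompose-unique x y (suc zero) zero       eq = contradiction eq (odd≢even x y)
decompose-unique x y (suc zero) (suc zero) eq = ℤ.*-cancelˡ-≡ (+ 2) x y (∙-cancelʳ (+ 1) _ _ eq) , refl

half : Point → Point
half (x , y) = (x /ℕ 2 , y /ℕ 2)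

Residue : Set
Residue = Fin 2 × Fin 2

residue : Point → Residue
residue (x , y) = (bit x , bit y)

corner : Residue → Point
corner (i , j) = (+ toℕ i , + toℕ j)

half-residue : ∀ p → p ≡ double (half p) ⊕ corner (residue p)
half-residue (x , y) = cong₂ _,_ (decompose x) (decompose y)

half-residue-unique : ∀ p q e f → double p ⊕ corner e ≡ double q ⊕ corner f → p ≡ q × e ≡ f
half-residue-unique (x , y) (x′ , y′) (i , j) (i′ , j′) eq
  with decompose-unique x x′ i i′ (cong proj₁ eq) | decompose-unique y y′ j j′ (cong proj₂ eq)
... | refl , refl | refl , refl = refl , refl

double-⊕-decompose : ∀ m p →
  half (double m ⊕ p) ≡ m ⊕ half p × residue (double m ⊕ p) ≡ residue p
double-⊕-decompose m p = half-residue-unique _ _ _ _ (begin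
  double (half q) ⊕ corner (residue q)               ≡⟨ half-residue q ⟨
  double m ⊕ p                                       ≡⟨ cong (double m ⊕_) (half-residue p) ⟩
  double m ⊕ (double (half p) ⊕ corner (residue p))  ≡⟨ ⊕-assoc (double m) _ _ ⟨
  (double m ⊕ double (half p)) ⊕ corner (residue p)
    ≡⟨ cong (_⊕ corner (residue p)) (double-⊕ m (half p)) ⟨
  double (m ⊕ half p) ⊕ corner (residue p)           ∎)
  where
  open ≡-Reasoning
  q = double m ⊕ p

-- Reduces claims about residues near an arbitrary point to the four corners, where they can be
-- decided.
residue-⊕ : ∀ p q → residue (p ⊕ q) ≡ residue (corner (residue p) ⊕ q)
residue-⊕ p q = begin
  residue (p ⊕ q)
    ≡⟨ cong (λ p → residue (p ⊕ q)) (half-residue p) ⟩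
  residue ((double (half p) ⊕ corner (residue p)) ⊕ q)
    ≡⟨ cong residue (⊕-assoc (double (half p)) _ _) ⟩
  residue (double (half p) ⊕ (corner (residue p) ⊕ q)) ≡⟨ proj₂ (double-⊕-decompose (half p) _) ⟩
  residue (corner (residue p) ⊕ q)                    ∎
  where open ≡-Reasoning

-- Directions, quadrants, arrows and the colouring rule.

infixl 6 _⊞_

_⊞_ : Fin 4 → Fin 4 → Fin 4
i ⊞ j = (toℕ i ℕ.+ toℕ j) mod 4

opposite : Fin 4 → Fin 4
opposite = _⊞ # 2

direction : Fin 4 → Point
direction d = fold (+ 1 , + 0) turn (toℕ d)

-- Anticlockwise around the origin, starting with the lower left cell, so that
-- a segment leaving p in direction d separates p ⊕ quadrant (d ⊞ # 1) on its
-- right from p ⊕ quadrant (d ⊞ # 2) on its left.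
quadrant : Fin 4 → Cell
quadrant k = fold (ℤ.-1ℤ , ℤ.-1ℤ) turnCell (toℕ k)

right left : Point → Fin 4 → Cell
right p d = p ⊕ quadrant (d ⊞ # 1)
left  p d = p ⊕ quadrant (d ⊞ # 2)

abstract
  quadrant-injective : ∀ i j → quadrant i ≡ quadrant j → i ≡ j
  quadrant-injective = decide (all? λ i → all? λ j → (quadrant i ≟ₚ quadrant j) →-dec (i ≟ j))

  direction-injective : ∀ i j → direction i ≡ direction j → i ≡ j
  direction-injective = decide (all? λ i → all? λ j → (direction i ≟ₚ direction j) →-dec (i ≟ j))

-- The arrow of the j-th quarter (numbered as quadrants of the centre) of a
-- doubled cell with arrow a: the quarters on the diagonal of a inherit it, the
-- other two get the centre as reflex vertex.
child : Fin 4 → Fin 4 → Fin 4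
child a j = if does (a ≟ opposite j) then a else j

-- The k-th cell around double m ⊕ corner e is the (sub e k)-th quarter of the
-- doubled cell m ⊕ quadrant (coarse e k).
coarse sub : Residue → Fin 4 → Fin 4
coarse (zero  , zero ) k = k
coarse (zero  , suc _) k = lookup (# 3 ∷ # 2 ∷ # 2 ∷ # 3 ∷ []) k
coarse (suc _ , zero ) k = lookup (# 1 ∷ # 1 ∷ # 2 ∷ # 2 ∷ []) k
coarse (suc _ , suc _) k = # 2

sub (zero  , zero ) k = opposite k
sub (zero  , suc _) k = lookup (# 1 ∷ # 0 ∷ # 3 ∷ # 2 ∷ []) k
sub (suc _ , zero ) k = lookup (# 3 ∷ # 2 ∷ # 1 ∷ # 0 ∷ []) k
sub (suc _ , suc _) k = k

-- The arrows of the four cells around a point.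
Block : Set
Block = Vec (Fin 4) 4

refine : Block → Residue → Block
refine b e = tabulate (λ k → child (lookup b (coarse e k)) (sub e k))

-- The cells to the right and to the left of direction d have different reflex
-- vertices, written without subtraction.
Edge : Block → Fin 4 → Set
Edge b d = quadrant (d ⊞ # 1) ⊕ quadrant (lookup b (d ⊞ # 2)) ≢
           quadrant (d ⊞ # 2) ⊕ quadrant (lookup b (d ⊞ # 1))

edge? : ∀ b d → Dec (Edge b d)
edge? b d = ¬? (_ ≟ₚ _)

-- At least three of four directions, put as all with at most one exception `m`, which may be an
-- edge too; this form avoids counting.
Branching : Block → Set
Branching b = ∃ λ m → ∀ d → d ≢ m → Edge b d

branching? : ∀ b → Dec (Branching b)
branching? b = any? λ m → all? λ d → ¬? (d ≟ m) →-dec edge? b d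

Parallel : Fin 4 → Fin 4 → Set
Parallel a k = a ≡ k ⊎ a ≡ opposite k

parallel? : ∀ a k → Dec (Parallel a k)
parallel? a k = (a ≟ k) ⊎-dec (a ≟ opposite k)

-- Cells are chequered by the diagonal along which they point.
Coherent : Block → Set
Coherent b = (∀ k → Parallel (lookup b k) k) ⊎ (∀ k → ¬ Parallel (lookup b k) k)

coherent? : ∀ b → Dec (Coherent b)
coherent? b =
  (all? λ k → parallel? (lookup b k) k) ⊎-dec
  (all? λ k → ¬? (parallel? (lookup b k) k))

-- If a cell points to the point, then so do the other cells of its tile.
Chairlike : Block → Set
Chairlike b = (∀ k → lookup b k ≢ k) ⊎ (∃ λ m → ∀ k → k ≢ m → lookup b k ≡ k)

chairlike? : ∀ b → Dec (Chairlike b)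
chairlike? b =
  (all? λ k → ¬? (lookup b k ≟ k)) ⊎-dec
  (any? λ m → all? λ k → ¬? (k ≟ m) →-dec (lookup b k ≟ k))

-- For a half of a doubled segment seen from the end that is twice a lattice
-- point, between doubled cells with arrows a (right) and b (left).  Adjacent
-- cells have different arrows, so a ≡ b means that the segment lies inside a
-- doubled cell.  The rule commutes with rotation; it was found by search.
paint : Fin 4 → Fin 4 → Fin 4 → Fin 4
paint d a b =
  if does (a ≟ b) then a
  else if does (a ≟ d ⊞ # 3) then (if does (b ≟ d) then d else d ⊞ # 1)
  else opposite d

-- Every segment has exactly one end whose coordinates have the same parity.
paintFrom : Residue → Fin 4 → Fin 4 → Fin 4 → Fin 4
paintFrom (i , j) d a b = if does (i ≟ j) then paint d a b else paint (opposite d) b a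

shade : Block → Residue → Fin 4 → Fin 4
shade b e d = paintFrom e d (lookup b (coarse e (d ⊞ # 1))) (lookup b (coarse e (d ⊞ # 2)))

Separates Agrees : Block → (Fin 4 → Fin 4) → Set
Separates f c = ∀ d d′ → Edge f d → Edge f d′ → d ≢ d′ → c d ≢ c d′
Agrees    f c = ∀ d d′ → Edge f d → Edge f d′ → c d ≡ c d′

-- The two cases are what a colouring must satisfy at points of degree at least three and at the
-- points that are not vertices.
Colours : Block → (Fin 4 → Fin 4) → Set
Colours f c = (Branching f × Separates f c) ⊎ (¬ Branching f × Agrees f c)

colours? : ∀ f c → Dec (Colours f c)
colours? f c =
  (branching? f ×-dec
    all? λ d → all? λ d′ → edge? f d →-dec edge? f d′ →-dec ¬? (d ≟ d′) →-dec ¬? (c d ≟ c d′))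
  ⊎-dec
  (¬? (branching? f) ×-dec
    all? λ d → all? λ d′ → edge? f d →-dec edge? f d′ →-dec (c d ≟ c d′))

colours-cong : ∀ f {c c′} → (∀ d → c d ≡ c′ d) → Colours f c → Colours f c′
colours-cong f c≗c′ (inj₁ (br , separates)) = inj₁ (br , λ d d′ p q d≢d′ eq →
  separates d d′ p q d≢d′ (trans (c≗c′ d) (trans eq (sym (c≗c′ d′)))))
colours-cong f c≗c′ (inj₂ (¬br , agrees)) = inj₂ (¬br , λ d d′ p q →
  trans (sym (c≗c′ d)) (trans (agrees d d′ p q) (c≗c′ d′)))

∀Block? : ∀ {P : Block → Set} → (∀ b → Dec (P b)) → Dec (∀ b → P b)
∀Block? P? = map′ (λ { h (i ∷ j ∷ k ∷ l ∷ []) → h i j k l }) (λ h i j k l → h _)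
  (all? λ i → all? λ j → all? λ k → all? λ l → P? (i ∷ j ∷ k ∷ l ∷ []))

∀Residue? : ∀ {P : Residue → Set} → (∀ e → Dec (P e)) → Dec (∀ e → P e)
∀Residue? P? = map′ uncurry (λ h i j → h (i , j)) (all? λ i → all? λ j → P? (i , j))

-- Finite verifications for blocks.

abstract
  three-of-four : ∀ i j k → i ≢ j → i ≢ k → j ≢ k →
    ∃ λ m → ∀ (d : Fin 4) → d ≢ m → d ≡ i ⊎ d ≡ j ⊎ d ≡ k
  three-of-four = decide (all? λ i → all? λ j → all? λ k →
    ¬? (i ≟ j) →-dec ¬? (i ≟ k) →-dec ¬? (j ≟ k) →-dec
    any? λ m → all? λ d → ¬? (d ≟ m) →-dec ((d ≟ i) ⊎-dec (d ≟ j) ⊎-dec (d ≟ k)))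

  -- The doubled cell `c` has centre `double c ⊕ 𝟏`, hence `j`-th quarter
  -- `double c ⊕ (𝟏 ⊕ quadrant j)`. This ties the tables `coarse` and `sub` to the geometry.
  coarse-sub : ∀ e k → corner e ⊕ quadrant k ≡ double (quadrant (coarse e k)) ⊕ (𝟏 ⊕ quadrant (sub e k))
  coarse-sub = decide (∀Residue? λ e → all? λ k → _ ≟ₚ _)

  half-coarse : ∀ e k → half (corner e ⊕ quadrant k) ≡ quadrant (coarse e k)
  half-coarse = decide (∀Residue? λ e → all? λ k → _ ≟ₚ _)

  -- A unit step changes the parity of one coordinate and reversal swaps right and left, so both
  -- ends apply `paint` at the same end.
  paintFrom-reverse : ∀ e d a b →
    paintFrom (residue (corner e ⊕ direction d)) (opposite d) b a ≡ paintFrom e d a b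
  paintFrom-reverse = decide (∀Residue? λ e → all? λ d → all? λ a → all? λ b → _ ≟ _)

  -- `child a j` is always parallel to `j`, and for given `e` either every `sub e k` is parallel to
  -- `k` or none is.
  refine-coherent : ∀ b e → Coherent (refine b e)
  refine-coherent = decide (∀Block? λ b → ∀Residue? λ e → coherent? (refine b e))

  -- By enumeration of 22 blocks: the sixteen without parallel arrows, the one with all arrows
  -- pointing away, and the five with parallel arrows of which at least three point in.
  shade-colours : ∀ b → Coherent b → Chairlike b → ∀ e → Colours (refine b e) (shade b e)
  shade-colours = decide (∀Block? λ b → coherent? b →-dec chairlike? b →-dec
    ∀Residue? λ e → colours? (refine b e) (shade b e))

  -- The first refinement leaves no arrow parallel to its quadrant, so in the second `child` always
  -- takes its default and the cell at `k` gets `opposite k`: four cells of four different tiles.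
  refine²-edge : ∀ b d → Edge (refine (refine b (# 1 , # 0)) (# 0 , # 0)) d
  refine²-edge = decide (∀Block? λ b → all? λ d → edge? (refine (refine b (# 1 , # 0)) (# 0 , # 0)) d)

-- Tiles seen from their reflex vertices.

reflexOf : Fin 4 → Point
reflexOf r = fold 𝟏 turn (toℕ r)

reflex : Tile → Point
reflex (tile r p) = p ⊕ reflexOf r

Covers : Fin 4 → Point → Set
Covers r x = Any (λ c → x ≡ fold c turnCell (toℕ r)) cellsC

covers? : ∀ r x → Dec (Covers r x)
covers? r x = Any.any? (λ c → x ≟ₚ _) cellsC

covers⇒∈ : ∀ r p {x} → Covers r x → p ⊕ x ∈ cells (tile r p)
covers⇒∈ r p = Any.map⁺ ∘ Any.map (cong (p ⊕_))

∈⇒covers : ∀ r p {x} → p ⊕ x ∈ cells (tile r p) → Covers r x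
∈⇒covers r p = Any.map (⊕-cancelˡ p) ∘ Any.map⁻

abstract
  -- At its reflex vertex `𝟏` the chair `C` lacks the upper right cell, `quadrant (# 2)`; rotation
  -- carries this to `opposite r`.
  covers-quadrants : ∀ r →
    All (λ c → ∃ λ k → k ≢ opposite r × fold c turnCell (toℕ r) ≡ reflexOf r ⊕ quadrant k) cellsC
  covers-quadrants = decide (all? λ r → All.all? (λ c →
    any? λ k → ¬? (k ≟ opposite r) ×-dec (_ ≟ₚ _)) cellsC)

  quadrant-covered : ∀ r k → k ≢ opposite r → Covers r (reflexOf r ⊕ quadrant k)
  quadrant-covered = decide (all? λ r → all? λ k →
    ¬? (k ≟ opposite r) →-dec covers? r (reflexOf r ⊕ quadrant k))

  common-quadrant : ∀ r s → ∃ λ k → k ≢ opposite r × k ≢ opposite s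
  common-quadrant = decide (all? λ r → all? λ s → any? λ k →
    ¬? (k ≟ opposite r) ×-dec ¬? (k ≟ opposite s))

  -- Three tiles of the dissection have their reflex vertices at the centres of the doubled cells,
  -- the fourth at the doubled reflex vertex. The fourth takes the quarter nearest to it from each
  -- doubled cell, which is the case `a ≡ opposite j` of `child`.
  quadrant-dissected : ∀ r k j → k ≢ opposite r →
    Any (λ t → let u = fold t turnTile (toℕ r) in
           child k j ≢ opposite (Tile.turns u) ×
           double (reflexOf r ⊕ quadrant k) ⊕ (𝟏 ⊕ quadrant j) ≡ reflex u ⊕ quadrant (child k j))
        dissectionC
  quadrant-dissected = decide (all? λ r → all? λ k → all? λ j → ¬? (k ≟ opposite r) →-dec
    Any.any? (λ t → ¬? (_ ≟ _) ×-dec (_ ≟ₚ _)) dissectionC)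

  -- `verticesC` runs anticlockwise, so the tile lies to the left of its sides.
  sides-anticlockwise : ∀ r i d (let v = vertex (tile r 𝟎)) →
    v i ⊕ direction d ≡ v (cyclicSuc i) →
    Covers r (left (v i) d) × ¬ Covers r (right (v i) d)
  sides-anticlockwise = decide (all? λ r → all? λ i → all? λ d →
    (_ ≟ₚ _) →-dec (covers? r _ ×-dec ¬? (covers? r _)))

  sides-clockwise : ∀ r i d (let v = vertex (tile r 𝟎)) →
    v (cyclicSuc i) ⊕ direction d ≡ v i →
    Covers r (right (v (cyclicSuc i)) d) × ¬ Covers r (left (v (cyclicSuc i)) d)
  sides-clockwise = decide (all? λ r → all? λ i → all? λ d →
    (_ ≟ₚ _) →-dec (covers? r _ ×-dec ¬? (covers? r _)))

  side-or-covered : ∀ r d (let v = vertex (tile r 𝟎)) →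
    -- The point from which direction `d` has the given cell on its left.
    All (λ c → let x = fold c turnCell (toℕ r) ⊕ (⊖ quadrant (d ⊞ # 2)) in
           Covers r (right x d) ⊎ ∃ λ i → v i ≡ x × v (cyclicSuc i) ≡ x ⊕ direction d)
        cellsC
  side-or-covered = decide (all? λ r → all? λ d → All.all? (λ c →
    covers? r _ ⊎-dec any? λ i → (_ ≟ₚ _) ×-dec (_ ≟ₚ _)) cellsC)

  across-right : ∀ d → direction d ⊕ quadrant (opposite d ⊞ # 2) ≡ quadrant (d ⊞ # 1)
  across-right = decide (all? λ d → _ ≟ₚ _)

  across-left : ∀ d → direction d ⊕ quadrant (opposite d ⊞ # 1) ≡ quadrant (d ⊞ # 2)
  across-left = decide (all? λ d → _ ≟ₚ _)

abstract
  ∈cells⇒quadrant : ∀ t {c} → c ∈ cells t →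
    ∃ λ k → k ≢ opposite (Tile.turns t) × c ≡ reflex t ⊕ quadrant k
  ∈cells⇒quadrant (tile r p) c∈t with ∈-map⁻ (λ c → p ⊕ fold c turnCell (toℕ r)) c∈t
  ... | x , x∈C , refl with All.lookup (covers-quadrants r) x∈C
  ... | k , k≢ , eq = k , k≢ , trans (cong (p ⊕_) eq) (sym (⊕-assoc p (reflexOf r) (quadrant k)))

quadrant∈cells : ∀ t k → k ≢ opposite (Tile.turns t) → reflex t ⊕ quadrant k ∈ cells t
quadrant∈cells (tile r p) k k≢ =
  subst (_∈ cells (tile r p)) (sym (⊕-assoc p (reflexOf r) (quadrant k)))
    (covers⇒∈ r p (quadrant-covered r k k≢))

reflex-translate : ∀ q t → reflex (translate q t) ≡ q ⊕ reflex t
reflex-translate q (tile r p) = ⊕-assoc q p (reflexOf r)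

∈-dissection : ∀ t k j → k ≢ opposite (Tile.turns t) →
  ∃ λ u → u ∈ dissection t × child k j ≢ opposite (Tile.turns u) ×
          double (reflex t ⊕ quadrant k) ⊕ (𝟏 ⊕ quadrant j) ≡ reflex u ⊕ quadrant (child k j)
∈-dissection (tile r p) k j k≢ with find (quadrant-dissected r k j k≢)
... | t , t∈C , k′≢ , eq =
  translate (double p) u , ∈-map⁺ (λ t → translate (double p) (fold t turnTile (toℕ r))) t∈C , k′≢ , (begin
    double ((p ⊕ reflexOf r) ⊕ quadrant k) ⊕ δ
      ≡⟨ cong (λ x → double x ⊕ δ) (⊕-assoc p _ _) ⟩
    double (p ⊕ (reflexOf r ⊕ quadrant k)) ⊕ δ          ≡⟨ cong (_⊕ δ) (double-⊕ p _) ⟩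
    (double p ⊕ double (reflexOf r ⊕ quadrant k)) ⊕ δ   ≡⟨ ⊕-assoc (double p) _ δ ⟩
    double p ⊕ (double (reflexOf r ⊕ quadrant k) ⊕ δ)   ≡⟨ cong (double p ⊕_) eq ⟩
    double p ⊕ (reflex u ⊕ quadrant (child k j))        ≡⟨ ⊕-assoc (double p) (reflex u) _ ⟨
    (double p ⊕ reflex u) ⊕ quadrant (child k j)
      ≡⟨ cong (_⊕ quadrant (child k j)) (reflex-translate (double p) u) ⟨
    reflex (translate (double p) u) ⊕ quadrant (child k j) ∎)
  where
  open ≡-Reasoning
  u = fold t turnTile (toℕ r)
  δ = 𝟏 ⊕ quadrant j

-- Segments at a point and sides of tiles.

seg : Point → Fin 4 → Segment
seg p zero                   = segment p horizontal
seg p (suc zero)             = segment p vertical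
-- Segments start at their left or lower end, here the far one.
seg p (suc (suc zero))       = segment (p ⊕ direction (# 2)) horizontal
seg p (suc (suc (suc zero))) = segment (p ⊕ direction (# 3)) vertical

there-and-back : ∀ p x y → x ⊕ y ≡ 𝟎 → (p ⊕ x) ⊕ y ≡ p
there-and-back p x y eq = trans (⊕-assoc p x y) (trans (cong (p ⊕_) eq) (⊕-identityʳ p))

seg-joins : ∀ p d → seg p d Joins p , (p ⊕ direction d)
seg-joins p zero                   = inj₁ (refl , refl)
seg-joins p (suc zero)             = inj₁ (refl , refl)
seg-joins p (suc (suc zero))       = inj₂ (refl , there-and-back p (direction (# 2)) (direction (# 0)) refl)
seg-joins p (suc (suc (suc zero))) = inj₂ (refl , there-and-back p (direction (# 3)) (direction (# 1)) refl)

seg-endpoint : ∀ p d → p EndpointOf seg p d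
seg-endpoint p d = [ (λ (eq , _) → inj₁ (sym eq)) , (λ (_ , eq) → inj₂ (sym eq)) ]′ (seg-joins p d)

endpoint⇒seg : ∀ {p} s → p EndpointOf s → ∃ λ d → s ≡ seg p d
endpoint⇒seg (segment _ horizontal) (inj₁ refl) = # 0 , refl
endpoint⇒seg (segment _ vertical)   (inj₁ refl) = # 1 , refl
endpoint⇒seg (segment q horizontal) (inj₂ refl) =
  # 2 , cong (λ x → segment x horizontal) (sym (there-and-back q (direction (# 0)) (direction (# 2)) refl))
endpoint⇒seg (segment q vertical)   (inj₂ refl) =
  # 3 , cong (λ x → segment x vertical) (sym (there-and-back q (direction (# 1)) (direction (# 3)) refl))

joins-unique : ∀ s {p q p′ q′} → s Joins p , q → s Joins p′ , q′ →
  (p ≡ p′ × q ≡ q′) ⊎ (p ≡ q′ × q ≡ p′)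
joins-unique s (inj₁ (refl , refl)) (inj₁ (refl , refl)) = inj₁ (refl , refl)
joins-unique s (inj₁ (refl , refl)) (inj₂ (refl , refl)) = inj₂ (refl , refl)
joins-unique s (inj₂ (refl , refl)) (inj₁ (refl , refl)) = inj₂ (refl , refl)
joins-unique s (inj₂ (refl , refl)) (inj₂ (refl , refl)) = inj₁ (refl , refl)

joins-endpoint : ∀ s {p q x} → s Joins p , q → x EndpointOf s → x ≡ p ⊎ x ≡ q
joins-endpoint s (inj₁ (refl , refl)) = id
joins-endpoint s (inj₂ (refl , refl)) = [ inj₂ , inj₁ ]′

seg-injective : ∀ p {d d′} → seg p d ≡ seg p d′ → d ≡ d′
seg-injective p {d} {d′} eq =
  direction-injective d d′ (⊕-cancelˡ p
    (case joins-unique (seg p d′)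
       (subst (_Joins p , (p ⊕ direction d)) eq (seg-joins p d)) (seg-joins p d′) of λ where
      (inj₁ (_ , q≡q′))     → q≡q′
      (inj₂ (p≡q′ , q≡p))   → trans q≡p p≡q′))

vertex-offset : ∀ r o i → vertex (tile r o) i ≡ o ⊕ vertex (tile r 𝟎) i
vertex-offset r o i = cong (o ⊕_) (sym (⊕-identityˡ (fold (lookup verticesC i) turn (toℕ r))))

module _ {p} r o i (p≡ : p ≡ vertex (tile r o) i) where

  private
    v = vertex (tile r 𝟎) i

  placed : ∀ x → p ⊕ x ≡ o ⊕ (v ⊕ x)
  placed x = trans (cong (_⊕ x) (trans p≡ (vertex-offset r o i))) (⊕-assoc o v x)

  placed-∈ : ∀ {x} → Covers r (v ⊕ x) → p ⊕ x ∈ cells (tile r o)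
  placed-∈ {x} cov = subst (_∈ cells (tile r o)) (sym (placed x)) (covers⇒∈ r o cov)

  placed-∉ : ∀ {x} → ¬ Covers r (v ⊕ x) → ¬ p ⊕ x ∈ cells (tile r o)
  placed-∉ {x} ¬cov p⊕x∈t = ¬cov (∈⇒covers r o (subst (_∈ cells (tile r o)) (placed x) p⊕x∈t))

  placed-step : ∀ {x} j → p ⊕ x ≡ vertex (tile r o) j → v ⊕ x ≡ vertex (tile r 𝟎) j
  placed-step {x} j eq = ⊕-cancelˡ o (trans (sym (placed x)) (trans eq (vertex-offset r o j)))

left-side : ∀ t p d → left p d ∈ cells t → ¬ right p d ∈ cells t → seg p d SideOf t
left-side (tile r o) p d left∈t right∉t with ∈-map⁻ (λ c → o ⊕ fold c turnCell (toℕ r)) left∈t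
... | c , c∈C , eq =
  [ (λ covered → contradiction
      (subst (_∈ cells (tile r o)) (sym (p⊕≡ _)) (covers⇒∈ r o covered)) right∉t)
  , (λ (i , vᵢ≡ , vᵢ₊₁≡) → i , subst₂ (seg p d Joins_,_)
      (trans p≡ (sym (trans (vertex-offset r o i) (cong (o ⊕_) vᵢ≡))))
      (trans (p⊕≡ (direction d))
        (sym (trans (vertex-offset r o (cyclicSuc i)) (cong (o ⊕_) vᵢ₊₁≡))))
      (seg-joins p d))
  ]′ (All.lookup (side-or-covered r d) c∈C)
  where
  open ≡-Reasoning
  q = quadrant (d ⊞ # 2)
  c′ = fold c turnCell (toℕ r)
  x = c′ ⊕ (⊖ q)
  p≡ : p ≡ o ⊕ x
  p≡ = begin
    p                   ≡⟨ ⊕-identityʳ p ⟨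
    p ⊕ 𝟎               ≡⟨ cong (p ⊕_) (⊕-inverseʳ q) ⟨
    p ⊕ (q ⊕ (⊖ q))     ≡⟨ ⊕-assoc p q (⊖ q) ⟨
    (p ⊕ q) ⊕ (⊖ q)     ≡⟨ cong (_⊕ (⊖ q)) eq ⟩
    (o ⊕ c′) ⊕ (⊖ q)    ≡⟨ ⊕-assoc o c′ (⊖ q) ⟩
    o ⊕ x               ∎
  p⊕≡ : ∀ y → p ⊕ y ≡ o ⊕ (x ⊕ y)
  p⊕≡ y = trans (cong (_⊕ y) p≡) (⊕-assoc o x y)

-- Colouring unit segments by axis and parity.

gridColour : Segment → Fin 4
gridColour (segment p horizontal) = proj₁ (residue p) ↑ˡ 2
gridColour (segment p vertical)   = 2 ↑ʳ proj₂ (residue p)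

abstract
  residue-corner : ∀ e → e ≡ residue (corner e)
  residue-corner = decide (∀Residue? λ e → ≡-dec _≟_ _≟_ _ _)

  -- The two horizontal segments at a point start at consecutive abscissae, the two vertical ones at
  -- consecutive ordinates, so all four colours occur.
  gridColour-corner : ∀ e d d′ → gridColour (seg (corner e) d) ≡ gridColour (seg (corner e) d′) → d ≡ d′
  gridColour-corner = decide (∀Residue? λ e → all? λ d → all? λ d′ → (_ ≟ _) →-dec (d ≟ d′))

gridColour-residue : ∀ p d → gridColour (seg p d) ≡ gridColour (seg (corner (residue p)) d)
gridColour-residue p zero                   = cong (λ e → proj₁ e ↑ˡ 2) (residue-corner (residue p))
gridColour-residue p (suc zero)             = cong (λ e → 2 ↑ʳ proj₂ e) (residue-corner (residue p))
gridColour-residue p (suc (suc zero))       = cong (λ e → proj₁ e ↑ˡ 2) (residue-⊕ p (direction (# 2)))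
gridColour-residue p (suc (suc (suc zero))) = cong (λ e → 2 ↑ʳ proj₂ e) (residue-⊕ p (direction (# 3)))

gridColour-separate : ∀ {p s s′} → p EndpointOf s → p EndpointOf s′ → s ≢ s′ → gridColour s ≢ gridColour s′
gridColour-separate {p} {s} {s′} p∈s p∈s′ s≢s′ same with endpoint⇒seg s p∈s | endpoint⇒seg s′ p∈s′
... | d , refl | d′ , refl = s≢s′ (cong (seg p) (gridColour-corner (residue p) d d′
  (trans (sym (gridColour-residue p d)) (trans same (gridColour-residue p d′)))))

-- From colourings of segments to the chromatic index.

module _ (T : Collection) (V : Pred Point 0ℓ) (col : Segment → Fin 4)
  (agree : ∀ {p s s′} → OnBoundary T s → OnBoundary T s′ → p EndpointOf s → p EndpointOf s′ →
           ¬ V p → col s ≡ col s′)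
  (separate : ∀ {p s s′} → OnBoundary T s → OnBoundary T s′ → p EndpointOf s → p EndpointOf s′ →
              V p → s ≢ s′ → col s ≢ col s′)
  where

  open Setoid (pieces T V) using (_≈_) renaming (refl to ≈-refl; sym to ≈-sym; trans to ≈-trans)

  colour-cong : ∀ {e f} → e ≈ f → col (proj₁ e) ≡ col (proj₁ f)
  colour-cong = EqClosure.gfold isEquivalence (col ∘ proj₁) λ {e f} → linked {e} {f}
    where
    linked : ∀ {e f} → Linked T V e f → col (proj₁ e) ≡ col (proj₁ f)
    linked (inj₁ eq) = cong col eq
    linked {_ , e∈T} {_ , f∈T} (inj₂ (p , ¬Vp , p∈e , p∈f)) = agree e∈T f∈T p∈e p∈f ¬Vp

  properEdgeColouring : ProperEdgeColouring (tilingGraph T V) 4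
  properEdgeColouring = record
    { colour = col ∘ proj₁
    ; cong   = colour-cong
    ; proper = λ { {p , Vp} (e′ , e≈e′ , p∈e′) (f′ , f≈f′ , p∈f′) e≉f same →
        separate (proj₂ e′) (proj₂ f′) p∈e′ p∈f′ Vp
          (λ e′≡f′ → e≉f (≈-trans e≈e′ (≈-trans (EqClosure.return (inj₁ e′≡f′)) (≈-sym f≈f′))))
          (trans (sym (colour-cong e≈e′)) (trans same (colour-cong f≈f′))) }
    }

  hasChromaticIndex4 : ∀ p → V p → (∀ d → OnBoundary T (seg p d)) → HasChromaticIndex (tilingGraph T V) 4
  hasChromaticIndex4 p Vp onBoundary = properEdgeColouring , λ m m<4 C →
    let open ProperEdgeColouring C
        i , j , i<j , same = pigeonhole m<4 (colour ∘ e)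
    in proper {p , Vp} {e i} {e j} (incident i) (incident j)
         -- No chain of links joins two of the four segments: `col` is constant along chains but
         -- differs on them.
         (λ eᵢ≈eⱼ → separate (onBoundary i) (onBoundary j) (seg-endpoint p i) (seg-endpoint p j) Vp
            (Fin.<⇒≢ i<j ∘ seg-injective p) (colour-cong eᵢ≈eⱼ))
         same
    where
    e : Fin 4 → BoundarySegment T
    e d = seg p d , onBoundary d
    incident : ∀ d → Graph.Incident (tilingGraph T V) (p , Vp) (e d)
    incident d = e d , ≈-refl , seg-endpoint p d

-- Arrows in a chair tiling.

module ChairTiling (T : Collection) (chair : IsChairTiling T) where

  tileAt : Cell → Tile
  tileAt c = proj₁ (proj₁ chair c)

  tileAt∈T : ∀ c → T (tileAt c)
  tileAt∈T c = proj₁ (proj₁ (proj₂ (proj₁ chair c)))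

  ∈tileAt : ∀ c → c ∈ cells (tileAt c)
  ∈tileAt c = proj₂ (proj₁ (proj₂ (proj₁ chair c)))

  tileAt-unique : ∀ {c t} → T t → c ∈ cells t → tileAt c ≡ t
  tileAt-unique {c} t∈T c∈t = proj₂ (proj₂ (proj₁ chair c)) (t∈T , c∈t)

  dissection⊆T : ∀ {t u} → T t → u ∈ dissection t → T u
  dissection⊆T {t} t∈T u∈t = proj₂ (proj₂ chair) (t , t∈T , u∈t)

  arrow : Cell → Fin 4
  arrow c = proj₁ (∈cells⇒quadrant (tileAt c) (∈tileAt c))

  arrow≢ : ∀ c → arrow c ≢ opposite (Tile.turns (tileAt c))
  arrow≢ c = proj₁ (proj₂ (∈cells⇒quadrant (tileAt c) (∈tileAt c)))

  head : Cell → Point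
  head c = reflex (tileAt c)

  head-arrow : ∀ c → c ≡ head c ⊕ quadrant (arrow c)
  head-arrow c = proj₂ (proj₂ (∈cells⇒quadrant (tileAt c) (∈tileAt c)))

  arrow-unique : ∀ {t k} → T t → k ≢ opposite (Tile.turns t) → arrow (reflex t ⊕ quadrant k) ≡ k
  arrow-unique {t} {k} t∈T k≢ = quadrant-injective _ _ (⊕-cancelˡ (reflex t) (begin
    reflex t ⊕ quadrant (arrow c)
      ≡⟨ cong (λ u → reflex u ⊕ quadrant (arrow c)) (tileAt-unique t∈T (quadrant∈cells t k k≢)) ⟨
    head c ⊕ quadrant (arrow c)    ≡⟨ head-arrow c ⟨
    reflex t ⊕ quadrant k          ∎))
    where
    open ≡-Reasoning
    c = reflex t ⊕ quadrant k

  -- Each tile leaves only one quadrant free at its reflex vertex, so two tiles with the same one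
  -- share a cell.
  reflex-injective : ∀ {t u} → T t → T u → reflex t ≡ reflex u → t ≡ u
  reflex-injective {t} {u} t∈T u∈T eq with common-quadrant (Tile.turns t) (Tile.turns u)
  ... | k , k≢t , k≢u = trans
    (sym (tileAt-unique t∈T (quadrant∈cells t k k≢t)))
    (tileAt-unique u∈T (subst (λ p → p ⊕ quadrant k ∈ cells u) (sym eq) (quadrant∈cells u k k≢u)))

  -- Because `T` contains `ω T`, the dissection of the tile at `c` consists of tiles of `T`, and one
  -- of them gives the quarter its arrow.
  arrow-child : ∀ c j → arrow (double c ⊕ (𝟏 ⊕ quadrant j)) ≡ child (arrow c) j
  arrow-child c j with ∈-dissection (tileAt c) (arrow c) j (arrow≢ c)
  ... | u , u∈ , k≢ , eq = begin
    arrow (double c ⊕ (𝟏 ⊕ quadrant j))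
      ≡⟨ cong (λ x → arrow (double x ⊕ (𝟏 ⊕ quadrant j))) (head-arrow c) ⟩
    arrow (double (head c ⊕ quadrant (arrow c)) ⊕ (𝟏 ⊕ quadrant j)) ≡⟨ cong arrow eq ⟩
    arrow (reflex u ⊕ quadrant (child (arrow c) j))
      ≡⟨ arrow-unique (dissection⊆T (tileAt∈T c) u∈) k≢ ⟩
    child (arrow c) j                                               ∎
    where open ≡-Reasoning

  around : Point → Block
  around p = tabulate (λ k → arrow (p ⊕ quadrant k))

  lookup-around : ∀ p k → lookup (around p) k ≡ arrow (p ⊕ quadrant k)
  lookup-around p = lookup∘tabulate _

  around-refine : ∀ m e → around (double m ⊕ corner e) ≡ refine (around m) e
  around-refine m e = tabulate-cong λ k → begin
    arrow ((double m ⊕ corner e) ⊕ quadrant k)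
      ≡⟨ cong arrow (trans (⊕-assoc (double m) _ _) (cong (double m ⊕_) (coarse-sub e k))) ⟩
    arrow (double m ⊕ (double (quadrant (coarse e k)) ⊕ (𝟏 ⊕ quadrant (sub e k))))
      ≡⟨ cong arrow (⊕-assoc (double m) _ _) ⟨
    arrow ((double m ⊕ double (quadrant (coarse e k))) ⊕ (𝟏 ⊕ quadrant (sub e k)))
      ≡⟨ cong (λ x → arrow (x ⊕ (𝟏 ⊕ quadrant (sub e k)))) (double-⊕ m _) ⟨
    arrow (double (m ⊕ quadrant (coarse e k)) ⊕ (𝟏 ⊕ quadrant (sub e k)))
      ≡⟨ arrow-child (m ⊕ quadrant (coarse e k)) (sub e k) ⟩
    child (arrow (m ⊕ quadrant (coarse e k))) (sub e k)
      ≡⟨ cong (λ a → child a (sub e k)) (lookup-around m (coarse e k)) ⟨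
    child (lookup (around m) (coarse e k)) (sub e k) ∎
    where open ≡-Reasoning

  around-half : ∀ p → around p ≡ refine (around (half p)) (residue p)
  around-half p = trans (cong around (half-residue p)) (around-refine (half p) (residue p))

  around-coherent : ∀ p → Coherent (around p)
  around-coherent p = subst Coherent (sym (around-half p)) (refine-coherent (around (half p)) (residue p))

  around-chairlike : ∀ p → Chairlike (around p)
  around-chairlike p with any? (λ k → lookup (around p) k ≟ k)
  ... | no none = inj₁ (λ k eq → none (k , eq))
  -- The exception is the quadrant that the tile leaves free.
  ... | yes (k , eq) = inj₂ (opposite (Tile.turns t) , λ j j≢ → begin
      lookup (around p) j         ≡⟨ lookup-around p j ⟩
      arrow (p ⊕ quadrant j)      ≡⟨ cong (λ q → arrow (q ⊕ quadrant j)) p≡head ⟩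
      arrow (head c ⊕ quadrant j) ≡⟨ arrow-unique (tileAt∈T c) j≢ ⟩
      j                           ∎)
    where
    open ≡-Reasoning
    c = p ⊕ quadrant k
    t = tileAt c
    p≡head : p ≡ head c
    p≡head = ⊕-cancelʳ (quadrant k) (trans (head-arrow c)
      (cong (λ a → head c ⊕ quadrant a) (trans (sym (lookup-around p k)) eq)))

  -- Boundary segments in terms of arrows.

  shift-head : ∀ p i j (let a = lookup (around p) i ; b = lookup (around p) j) →
    p ⊕ (quadrant i ⊕ quadrant b) ≡ head (p ⊕ quadrant i) ⊕ (quadrant a ⊕ quadrant b)
  shift-head p i j = begin
    p ⊕ (quadrant i ⊕ quadrant b)                ≡⟨ ⊕-assoc p _ _ ⟨
    (p ⊕ quadrant i) ⊕ quadrant b                ≡⟨ cong (_⊕ quadrant b) (head-arrow c) ⟩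
    (head c ⊕ quadrant (arrow c)) ⊕ quadrant b   ≡⟨ ⊕-assoc (head c) _ _ ⟩
    head c ⊕ (quadrant (arrow c) ⊕ quadrant b)
      ≡⟨ cong (λ a → head c ⊕ (quadrant a ⊕ quadrant b)) (lookup-around p i) ⟨
    head c ⊕ (quadrant (lookup (around p) i) ⊕ quadrant b) ∎
    where
    open ≡-Reasoning
    c = p ⊕ quadrant i
    b = lookup (around p) j

  -- By `shift-head`, adding the quadrants of both arrows turns the two heads into the two sides of
  -- the equation in `Edge`, translated by `p`.
  heads-equal⇒ : ∀ p i j (let a = lookup (around p) i ; b = lookup (around p) j) →
    head (p ⊕ quadrant i) ≡ head (p ⊕ quadrant j) → quadrant i ⊕ quadrant b ≡ quadrant j ⊕ quadrant a
  heads-equal⇒ p i j eq = ⊕-cancelˡ p (trans (shift-head p i j)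
    (trans (cong₂ _⊕_ eq (⊕-comm (quadrant (lookup (around p) i)) _)) (sym (shift-head p j i))))

  ⇒heads-equal : ∀ p i j (let a = lookup (around p) i ; b = lookup (around p) j) →
    quadrant i ⊕ quadrant b ≡ quadrant j ⊕ quadrant a → head (p ⊕ quadrant i) ≡ head (p ⊕ quadrant j)
  ⇒heads-equal p i j eq = ⊕-cancelʳ (quadrant a ⊕ quadrant b) (begin
    head (p ⊕ quadrant i) ⊕ (quadrant a ⊕ quadrant b)  ≡⟨ shift-head p i j ⟨
    p ⊕ (quadrant i ⊕ quadrant b)                      ≡⟨ cong (p ⊕_) eq ⟩
    p ⊕ (quadrant j ⊕ quadrant a)                      ≡⟨ shift-head p j i ⟩
    head (p ⊕ quadrant j) ⊕ (quadrant b ⊕ quadrant a)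
      ≡⟨ cong (head (p ⊕ quadrant j) ⊕_) (⊕-comm (quadrant b) (quadrant a)) ⟩
    head (p ⊕ quadrant j) ⊕ (quadrant a ⊕ quadrant b)  ∎)
    where
    open ≡-Reasoning
    a = lookup (around p) i
    b = lookup (around p) j

  heads-differ : ∀ {t c c′} → T t → c ∈ cells t → ¬ c′ ∈ cells t → head c ≢ head c′
  heads-differ {t} {c} {c′} t∈T c∈t c′∉t eq = c′∉t (subst (λ u → c′ ∈ cells u) tileAt-c′ (∈tileAt c′))
    where
    tileAt-c′ : tileAt c′ ≡ t
    tileAt-c′ = trans (sym (reflex-injective (tileAt∈T c) (tileAt∈T c′) eq)) (tileAt-unique t∈T c∈t)

  onBoundary⇒edge : ∀ p d → OnBoundary T (seg p d) → Edge (around p) d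
  onBoundary⇒edge p d (tile r o , t∈T , i , joins) same
    with joins-unique (seg p d) (seg-joins p d) joins | ⇒heads-equal p (d ⊞ # 1) (d ⊞ # 2) same
  -- Here `d` follows the anticlockwise boundary and the tile is on its left; in the other case it
  -- is on the right.
  ... | inj₁ (p≡ , q≡) | eq =
    heads-differ t∈T (placed-∈ r o i p≡ (proj₁ sides)) (placed-∉ r o i p≡ (proj₂ sides)) (sym eq)
    where sides = sides-anticlockwise r i d (placed-step r o i p≡ (cyclicSuc i) q≡)
  ... | inj₂ (p≡ , q≡) | eq =
    heads-differ t∈T (placed-∈ r o (cyclicSuc i) p≡ (proj₁ sides))
      (placed-∉ r o (cyclicSuc i) p≡ (proj₂ sides)) eq
    where sides = sides-clockwise r i d (placed-step r o (cyclicSuc i) p≡ i q≡)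

  edge⇒onBoundary : ∀ p d → Edge (around p) d → OnBoundary T (seg p d)
  edge⇒onBoundary p d edge = t , tileAt∈T c , left-side t p d (∈tileAt c) right∉t
    where
    c = left p d
    t = tileAt c
    right∉t : ¬ right p d ∈ cells t
    right∉t right∈t = edge
      (heads-equal⇒ p (d ⊞ # 1) (d ⊞ # 2) (cong reflex (tileAt-unique (tileAt∈T c) right∈t)))

  -- The colouring for vertices of degree at least three.

  half-quadrant : ∀ p k → half (p ⊕ quadrant k) ≡ half p ⊕ quadrant (coarse (residue p) k)
  half-quadrant p k = begin
    half (p ⊕ quadrant k)
      ≡⟨ cong (λ q → half (q ⊕ quadrant k)) (half-residue p) ⟩
    half ((double (half p) ⊕ corner (residue p)) ⊕ quadrant k)
      ≡⟨ cong half (⊕-assoc (double (half p)) _ _) ⟩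
    half (double (half p) ⊕ (corner (residue p) ⊕ quadrant k))
      ≡⟨ proj₁ (double-⊕-decompose (half p) _) ⟩
    half p ⊕ half (corner (residue p) ⊕ quadrant k)
      ≡⟨ cong (half p ⊕_) (half-coarse (residue p) k) ⟩
    half p ⊕ quadrant (coarse (residue p) k)                 ∎
    where open ≡-Reasoning

  -- `half c` is the cell whose double contains `c`, so these are arrows one level up.
  hue : Point → Fin 4 → Fin 4
  hue p d = paintFrom (residue p) d (arrow (half (right p d))) (arrow (half (left p d)))

  hue-shade : ∀ p d → hue p d ≡ shade (around (half p)) (residue p) d
  hue-shade p d = cong₂ (paintFrom (residue p) d) (arrow-half (d ⊞ # 1)) (arrow-half (d ⊞ # 2))
    where
    arrow-half : ∀ k → arrow (half (p ⊕ quadrant k)) ≡ lookup (around (half p)) (coarse (residue p) k)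
    arrow-half k = trans (cong arrow (half-quadrant p k)) (sym (lookup-around (half p) (coarse (residue p) k)))

  -- Makes the colour a property of the segment, as `colour` evaluates `hue` at the start, which in
  -- two directions is the far end.
  hue-reverse : ∀ p d → hue (p ⊕ direction d) (opposite d) ≡ hue p d
  hue-reverse p d = begin
    hue q (opposite d)
      ≡⟨ cong₂ (λ c c′ → paintFrom (residue q) (opposite d) (arrow (half c)) (arrow (half c′)))
           (trans (⊕-assoc p _ _) (cong (p ⊕_) (across-left d)))
           (trans (⊕-assoc p _ _) (cong (p ⊕_) (across-right d))) ⟩
    paintFrom (residue q) (opposite d) (arrow (half (left p d))) (arrow (half (right p d)))
      ≡⟨ cong (λ e → paintFrom e (opposite d) (arrow (half (left p d))) (arrow (half (right p d))))
           (residue-⊕ p (direction d)) ⟩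
    paintFrom (residue (corner (residue p) ⊕ direction d)) (opposite d)
      (arrow (half (left p d))) (arrow (half (right p d)))
      ≡⟨ paintFrom-reverse (residue p) d (arrow (half (right p d))) (arrow (half (left p d))) ⟩
    hue p d ∎
    where
    open ≡-Reasoning
    q = p ⊕ direction d

  colour : Segment → Fin 4
  colour (segment p horizontal) = hue p (# 0)
  colour (segment p vertical)   = hue p (# 1)

  colour-seg : ∀ p d → colour (seg p d) ≡ hue p d
  colour-seg p zero                   = refl
  colour-seg p (suc zero)             = refl
  colour-seg p (suc (suc zero))       = hue-reverse p (# 2)
  colour-seg p (suc (suc (suc zero))) = hue-reverse p (# 3)

  colour-colours : ∀ p → Colours (around p) (λ d → colour (seg p d))
  colour-colours p = colours-cong (around p) (λ d → sym (trans (colour-seg p d) (hue-shade p d)))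
    (subst (λ f → Colours f (shade (around (half p)) (residue p))) (sym (around-half p))
      -- The constraints are applied one level up, at `half p`.
      (shade-colours (around (half p)) (around-coherent (half p)) (around-chairlike (half p)) (residue p)))

  branching⇒degree≥3 : ∀ p → Branching (around p) → DegreeAtLeastThree T p
  branching⇒degree≥3 p (m , edge) =
    (λ i → seg p (punchIn m i)) , (λ eq → punchIn-injective m _ _ (seg-injective p eq)) ,
    (λ i → edge⇒onBoundary p _ (edge _ (punchInᵢ≢i m i)) , seg-endpoint p _)

  degree≥3⇒branching : ∀ p → DegreeAtLeastThree T p → Branching (around p)
  degree≥3⇒branching p (s , s-injective , at-p) with three-of-four (d (# 0)) (d (# 1)) (d (# 2))
      (d-injective λ ()) (d-injective λ ()) (d-injective λ ())
    where
    d : Fin 3 → Fin 4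
    d i = proj₁ (endpoint⇒seg (s i) (proj₂ (at-p i)))
    d-injective : ∀ {i j} → i ≢ j → d i ≢ d j
    d-injective {i} {j} i≢j eq = i≢j (s-injective (trans (proj₂ (endpoint⇒seg (s i) (proj₂ (at-p i))))
      (trans (cong (seg p) eq) (sym (proj₂ (endpoint⇒seg (s j) (proj₂ (at-p j))))))))
  ... | m , covered = m , λ d d≢m → case covered d d≢m of λ where
      (inj₁ refl)        → edge (# 0)
      (inj₂ (inj₁ refl)) → edge (# 1)
      (inj₂ (inj₂ refl)) → edge (# 2)
    where
    edge : ∀ i → Edge (around p) (proj₁ (endpoint⇒seg (s i) (proj₂ (at-p i))))
    edge i = onBoundary⇒edge p _
      (subst (OnBoundary T) (proj₂ (endpoint⇒seg (s i) (proj₂ (at-p i)))) (proj₁ (at-p i)))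

  colour-agree : ∀ {p s s′} → OnBoundary T s → OnBoundary T s′ → p EndpointOf s → p EndpointOf s′ →
    ¬ DegreeAtLeastThree T p → colour s ≡ colour s′
  colour-agree {p} {s} {s′} s∈T s′∈T p∈s p∈s′ ¬V with endpoint⇒seg s p∈s | endpoint⇒seg s′ p∈s′
  ... | d , refl | d′ , refl =
    [ (λ (branching , _) → contradiction (branching⇒degree≥3 p branching) ¬V)
    , (λ (_ , agrees) → agrees d d′ (onBoundary⇒edge p d s∈T) (onBoundary⇒edge p d′ s′∈T))
    ]′ (colour-colours p)

  colour-separate : ∀ {p s s′} → OnBoundary T s → OnBoundary T s′ → p EndpointOf s → p EndpointOf s′ →
    DegreeAtLeastThree T p → s ≢ s′ → colour s ≢ colour s′
  colour-separate {p} {s} {s′} s∈T s′∈T p∈s p∈s′ Vp s≢s′ with endpoint⇒seg s p∈s | endpoint⇒seg s′ p∈s′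
  ... | d , refl | d′ , refl =
    [ (λ (_ , separates) → separates d d′ (onBoundary⇒edge p d s∈T) (onBoundary⇒edge p d′ s′∈T)
        (s≢s′ ∘ cong (seg p)))
    , (λ (¬branching , _) → contradiction (degree≥3⇒branching p Vp) ¬branching)
    ]′ (colour-colours p)

  -- Twice the point (1 , 0), whose coordinate sum is odd.
  crossing : Point
  crossing = (+ 2 , + 0)

  -- `crossing` is twice `(+ 1 , + 0)`, itself `double 𝟎 ⊕ corner (# 1 , # 0)`, so its block is a
  -- double refinement of the one at the origin, whatever that is.
  crossing-edge : ∀ d → Edge (around crossing) d
  crossing-edge d = subst (λ b → Edge b d)
    (sym (trans (around-refine (+ 1 , + 0) (# 0 , # 0))
      (cong (λ b → refine b (# 0 , # 0)) (around-refine 𝟎 (# 1 , # 0)))))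
    (refine²-edge (around 𝟎) d)

  crossing-onBoundary : ∀ d → OnBoundary T (seg crossing d)
  crossing-onBoundary d = edge⇒onBoundary crossing d (crossing-edge d)

  -- Makes `agree` vacuous for `EightPerTile`: distinct unit segments are never linked.
  endpoint⇒vertex : ∀ {p} s → OnBoundary T s → p EndpointOf s → EightPerTile T p
  endpoint⇒vertex s (t , t∈T , i , joins) p∈s = case joins-endpoint s joins p∈s of λ where
    (inj₁ p≡) → t , t∈T , i , sym p≡
    (inj₂ p≡) → t , t∈T , cyclicSuc i , sym p≡

proposition3p1 : (T : Collection) → IsChairTiling T →
    HasChromaticIndex (tilingGraph T (EightPerTile T)) 4
    × HasChromaticIndex (tilingGraph T (DegreeAtLeastThree T)) 4
proposition3p1 T chair =
  hasChromaticIndex4 T (EightPerTile T) gridColour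
    (λ {_} {s} s∈T _ p∈s _ ¬V → contradiction (endpoint⇒vertex s s∈T p∈s) ¬V)
    (λ _ _ p∈s p∈s′ _ → gridColour-separate p∈s p∈s′)
    crossing (endpoint⇒vertex (seg crossing (# 0)) (crossing-onBoundary (# 0)) (seg-endpoint crossing (# 0)))
    crossing-onBoundary ,
  hasChromaticIndex4 T (DegreeAtLeastThree T) colour colour-agree colour-separate
    crossing (branching⇒degree≥3 crossing (# 0 , λ d _ → crossing-edge d)) crossing-onBoundary
  where open ChairTiling T chair
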